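{- Consider the colored markings logic $\mathrm{CML}(\mathbb{N}^2,\{0\},\{\leq\})$, i.e. the logic in which every token carries $2$ colors that are natural numbers, the only operation on colors is the constant $0$, and the only predicate on colors is the usual order $\leq$ on $\mathbb{N}$. The satisfiability problem of the fragment $\Pi_2$ of $\mathrm{CML}(\mathbb{N}^2,\{0\},\{\leq\})$ (given a finite set of places $\mathbb{P}$ and a $\Pi_2$ formula $\varphi$ over $\mathbb{P}$, decide whether $\varphi$ is satisfiable) is undecidable.
   Context: Tokens are the natural numbers. Let $\mathbb{P}$ be a finite set of places, $\mathbb{C}$ a (possibly infinite) color domain, $N\ge 1$ an integer, $\Omega$ a set of operations on $\mathbb{C}$ and $\Xi$ a set of predicates (relations) on $\mathbb{C}$. An $N$-dim colored marking is a mapping $M:\mathbb{N}\to(\mathbb{P}\cup\{\bot\})\times\mathbb{C}^N$; if $M(t)=(p,c_1,\ldots,c_N)$, write $\mathit{place}_M(t)=p$ and $\mathit{color}_{M,k}(t)=c_k$. Syntax of $\mathrm{CML}(\mathbb{C}^N,\Omega,\Xi)$. Let $T$ be a set of token variables (ranging over $\mathbb{N}$) and $C$ a disjoint set of color variables (ranging over $\mathbb{C}$). Token color terms: $t ::= z \mid \delta_k(x)\mid o(t_1,\ldots,t_n)$ with $z\in C$, $1\le k\le N$, $x\in T$, $o\in\Omega$. Formulas: $\varphi ::= \mathit{true}\mid x=y\mid p(x)\mid r(t_1,\ldots,t_m)\mid\neg\varphi\mid\varphi\vee\varphi\mid\exists z.\,\varphi\mid\exists x.\,\varphi$ with $x,y\in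 T$, $z\in C$, $p\in\mathbb{P}\cup\{\bot\}$, $r\in\Xi$. Other connectives and $\forall$ are defined as usual. Semantics. For valuations $\theta:T\to\mathbb{N}$, $\nu:C\to\mathbb{C}$ and a marking $M$, the term $z$ denotes $\nu(z)$, the term $\delta_k(x)$ denotes $\mathit{color}_{M,k}(\theta(x))$, and operations are interpreted on $\mathbb{C}$. $M\models_{\theta,\nu}x=y$ iff $\theta(x)=\theta(y)$; $M\models_{\theta,\nu}p(x)$ iff $\mathit{place}_M(\theta(x))=p$; $M\models_{\theta,\nu} r(t_1,\ldots,t_m)$ iff $r$ holds of the values of $t_1,\dots,t_m$; boolean connectives are as usual; $\exists x$ ($x\in T$) quantifies over all tokens in $\mathbb{N}$ and $\exists z$ ($z\in C$) over all elements of $\mathbb{C}$. A formula $\varphi$ is satisfiable iff there are $\theta,\nu$ and a colored marking $M$ with $M\models_{\theta,\nu}\varphi$. Fragments. A formula is in prenex normal form (PNF) if it is $Q_1y_1\ldots Q_my_m.\,\varphi$ with $Q_i\in\{\exists,\forall\}$, $y_i\in T\cup C$, $\varphi$ quantifier-free. $\Sigma_0=\Pi_0$ is the set of formulas in PNF where all quantified variables are in $C$. For $n\ge0$, $\Sigma_{n+1}$ (resp. $\Pi_{n+1}$) is the set of PNF formulas $Qy_1\ldots y_m.\,\varphi$ with $y_1,\ldots,y_m\in T\cup C$, $Q$ being $\exists$ (resp. $\forall$) and $\varphi\in\Pi_n$ (resp. $\varphi\in\Sigma_n$). A formula not literally in PNF is classified through its prenex normal form. -}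

module Defs where

open import Data.Bool using (if_then_else_)
open import Data.Fin using (Fin; toℕ)
open import Data.Maybe using (Maybe; just; nothing)
open import Data.Nat using (ℕ; zero; suc; _+_; _≤_; _<_; _≟_)
open import Data.Product using (_×_; _,_; proj₁; proj₂; ∃-syntax)
open import Data.Sum using (_⊎_)
open import Data.Unit using (⊤; tt)
open import Data.Vec using (Vec; []; _∷_; lookup)
open import Data.Vec.Relation.Binary.Pointwise.Inductive using (Pointwise)
open import Relation.Binary.PropositionalEquality using (_≡_)
open import Relation.Nullary using (¬_; does)

record Operations (ℂ : Set) : Set₁ where
  field
    Sym    : Set
    arity  : Sym → ℕ
    interp : (o : Sym) → Vec ℂ (arity o) → ℂ

record Predicates (ℂ : Set) : Set₁ where
  field
    Sym    : Set
    arity  : Sym → ℕ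
    interp : (r : Sym) → Vec ℂ (arity r) → Set

-- Token variables and color variables are both named by natural numbers;
-- they are kept disjoint by using separate constructors.
data Var : Set where
  tok col : ℕ → Var

infixl 20 _[_↦_]

_[_↦_] : {A : Set} → (ℕ → A) → ℕ → A → (ℕ → A)
(ρ [ x ↦ a ]) y = if does (y ≟ x) then a else ρ y

-- The logic CML(ℂᴺ, Ω, Ξ) over the set of places ℙ.
module CML {ℂ : Set} (N : ℕ) (Ω : Operations ℂ) (Ξ : Predicates ℂ) (ℙ : Set) where

  private
    module Ω = Operations Ω
    module Ξ = Predicates Ξ

  -- `nothing` is the extra place ⊥.
  Marking : Set
  Marking = ℕ → Maybe ℙ × Vec ℂ N

  place : Marking → ℕ → Maybe ℙ
  place M t = proj₁ (M t)

  color : Marking → Fin N → ℕ → ℂ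
  color M k t = lookup (proj₂ (M t)) k

  data Term : Set where
    var : ℕ → Term
    δ   : Fin N → ℕ → Term
    op  : (o : Ω.Sym) → Vec Term (Ω.arity o) → Term

  infix  7 _≐_
  infixr 5 _∨′_

  data Formula : Set where
    true : Formula
    _≐_  : ℕ → ℕ → Formula
    at   : Maybe ℙ → ℕ → Formula
    rel  : (r : Ξ.Sym) → Vec Term (Ξ.arity r) → Formula
    ¬′_  : Formula → Formula
    _∨′_ : Formula → Formula → Formula
    ∃′   : Var → Formula → Formula

  ∀′ : Var → Formula → Formula
  ∀′ y φ = ¬′ (∃′ y (¬′ φ))

  module _ (M : Marking) where

    mutual
      ⟦_⟧ : Term → (θ : ℕ → ℕ) (ν : ℕ → ℂ) → ℂ
      ⟦ var z ⟧   θ ν = ν z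
      ⟦ δ k x ⟧   θ ν = color M k (θ x)
      ⟦ op o ts ⟧ θ ν = Ω.interp o (⟦ ts ⟧* θ ν)

      ⟦_⟧* : ∀ {n} → Vec Term n → (θ : ℕ → ℕ) (ν : ℕ → ℂ) → Vec ℂ n
      ⟦ [] ⟧*     θ ν = []
      ⟦ t ∷ ts ⟧* θ ν = ⟦ t ⟧ θ ν ∷ ⟦ ts ⟧* θ ν

  Models : Marking → (θ : ℕ → ℕ) (ν : ℕ → ℂ) → Formula → Set
  Models M θ ν true           = ⊤
  Models M θ ν (x ≐ y)        = θ x ≡ θ y
  Models M θ ν (at p x)       = place M (θ x) ≡ p
  Models M θ ν (rel r ts)     = Ξ.interp r (⟦_⟧* M ts θ ν)
  Models M θ ν (¬′ φ)         = ¬ Models M θ ν φ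
  Models M θ ν (φ ∨′ ψ)       = Models M θ ν φ ⊎ Models M θ ν ψ
  Models M θ ν (∃′ (tok x) φ) = ∃[ t ] Models M (θ [ x ↦ t ]) ν φ
  Models M θ ν (∃′ (col z) φ) = ∃[ c ] Models M θ (ν [ z ↦ c ]) φ

  Satisfiable : Formula → Set
  Satisfiable φ = ∃[ θ ] ∃[ ν ] ∃[ M ] Models M θ ν φ

  data QuantifierFree : Formula → Set where
    true : QuantifierFree true
    _≐_  : ∀ x y → QuantifierFree (x ≐ y)
    at   : ∀ p x → QuantifierFree (at p x)
    rel  : ∀ r ts → QuantifierFree (rel r ts)
    ¬′_  : ∀ {φ} → QuantifierFree φ → QuantifierFree (¬′ φ)
    _∨′_ : ∀ {φ ψ} → QuantifierFree φ → QuantifierFree ψ → QuantifierFree (φ ∨′ ψ)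

  -- Prenex formulas all of whose quantified variables are color variables.
  data ColorPrenex : Formula → Set where
    matrix : ∀ {φ} → QuantifierFree φ → ColorPrenex φ
    ∃ᶜ     : ∀ z {φ} → ColorPrenex φ → ColorPrenex (∃′ (col z) φ)
    ∀ᶜ     : ∀ z {φ} → ColorPrenex φ → ColorPrenex (∀′ (col z) φ)

  -- Q y₁ … yₘ . φ with φ in F; m = 0 is allowed, so each level of the
  -- hierarchy below contains the dual class one level down.
  data Block (Q : Var → Formula → Formula) (F : Formula → Set) : Formula → Set where
    body  : ∀ {φ} → F φ → Block Q F φ
    quant : ∀ y {φ} → Block Q F φ → Block Q F (Q y φ)

  mutual
    IsΣ : ℕ → Formula → Set
    IsΣ zero    = ColorPrenex
    IsΣ (suc n) = Block ∃′ (IsΠ n)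

    IsΠ : ℕ → Formula → Set
    IsΠ zero    = ColorPrenex
    IsΠ (suc n) = Block ∀′ (IsΣ n)

zeroOp : Operations ℕ
zeroOp = record { Sym = ⊤ ; arity = λ _ → 0 ; interp = λ { tt [] → 0 } }

leqPred : Predicates ℕ
leqPred = record { Sym = ⊤ ; arity = λ _ → 2 ; interp = λ { tt (a ∷ b ∷ []) → a ≤ b } }

-- CML(ℕ², {0}, {≤}) over n places.
module CML≤ (n : ℕ) = CML 2 zeroOp leqPred (Fin n)

record Π₂Instance : Set where
  field
    places  : ℕ
    formula : CML≤.Formula places
    isΠ₂    : CML≤.IsΠ places 2 formula

Π₂Satisfiable : Π₂Instance → Set
Π₂Satisfiable i = CML≤.Satisfiable places formula
  where open Π₂Instance i

-- Gödel numbering, by iterating the Cantor pairing function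
-- (a , b) ↦ (a + b)(a + b + 1)/2 + b.

triangle : ℕ → ℕ
triangle zero    = 0
triangle (suc n) = suc n + triangle n

pair : ℕ → ℕ → ℕ
pair a b = triangle (a + b) + b

codeVar : Var → ℕ
codeVar (tok x) = pair 0 x
codeVar (col z) = pair 1 z

module _ {n : ℕ} where
  open CML≤ n

  codePlace : Maybe (Fin n) → ℕ
  codePlace nothing  = 0
  codePlace (just p) = suc (toℕ p)

  codeTerm : Term → ℕ
  codeTerm (var z)    = pair 0 z
  codeTerm (δ k x)    = pair 1 (pair (toℕ k) x)
  codeTerm (op tt []) = pair 2 0

  codeFormula : Formula → ℕ
  codeFormula true                   = pair 0 0
  codeFormula (x ≐ y)                = pair 1 (pair x y)
  codeFormula (at p x)               = pair 2 (pair (codePlace p) x)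
  codeFormula (rel tt (s ∷ t ∷ []))  = pair 3 (pair (codeTerm s) (codeTerm t))
  codeFormula (¬′ φ)                 = pair 4 (codeFormula φ)
  codeFormula (φ ∨′ ψ)               = pair 5 (pair (codeFormula φ) (codeFormula ψ))
  codeFormula (∃′ y φ)               = pair 6 (pair (codeVar y) (codeFormula φ))

code : Π₂Instance → ℕ
code i = pair places (codeFormula formula)
  where open Π₂Instance i

-- Partial (μ-)recursive functions ℕⁿ ⇀ ℕ.
data Rec : ℕ → Set where
  zeroᴿ : Rec 0
  sucᴿ  : Rec 1
  proj  : ∀ {n} → Fin n → Rec n
  comp  : ∀ {m n} → Rec m → Vec (Rec n) m → Rec n
  prim  : ∀ {n} → Rec n → Rec (2 + n) → Rec (1 + n)
  min   : ∀ {n} → Rec (1 + n) → Rec n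

infix 4 _[_]⇓_

data _[_]⇓_ : ∀ {n} → Rec n → Vec ℕ n → ℕ → Set where
  zero⇓ : zeroᴿ [ [] ]⇓ 0
  suc⇓  : ∀ {x} → sucᴿ [ x ∷ [] ]⇓ suc x
  proj⇓ : ∀ {n} {i : Fin n} {xs} → proj i [ xs ]⇓ lookup xs i
  comp⇓ : ∀ {m n} {f : Rec m} {gs : Vec (Rec n) m} {xs ys z} →
          Pointwise (λ g y → g [ xs ]⇓ y) gs ys → f [ ys ]⇓ z →
          comp f gs [ xs ]⇓ z
  prim⇓-zero : ∀ {n} {g : Rec n} {h xs z} →
          g [ xs ]⇓ z →
          prim g h [ 0 ∷ xs ]⇓ z
  prim⇓-suc  : ∀ {n} {g : Rec n} {h xs k y z} →
          prim g h [ k ∷ xs ]⇓ y → h [ k ∷ y ∷ xs ]⇓ z →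
          prim g h [ suc k ∷ xs ]⇓ z
  min⇓  : ∀ {n} {f : Rec (1 + n)} {xs k} →
          f [ k ∷ xs ]⇓ 0 → (∀ j → j < k → ∃[ v ] f [ j ∷ xs ]⇓ suc v) →
          min f [ xs ]⇓ k

-- Classically, a decider halts on every instance with the right answer.
-- Stating this as two implications, rather than as a sum, does not demand
-- evidence for `P i ⊎ ¬ P i`, so that undecidability is not weakened by a
-- constructive reading.
_Decides_via_ : {I : Set} → Rec 1 → (I → Set) → (I → ℕ) → Set
f Decides P via enc = ∀ i → (P i → f [ enc i ∷ [] ]⇓ 1) × (¬ P i → f [ enc i ∷ [] ]⇓ 0)

Undecidable : {I : Set} → (I → Set) → (I → ℕ) → Set
Undecidable P enc = ¬ (∃[ f ] f Decides P via enc)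

{-# OPTIONS --safe #-}
module Submission where

-- A place of a colored marking with two colors is a binary relation on ℕ.  With
-- lists of numbers represented by cells (head and tail), a token (l , r) at the
-- place `eval` records that the program numbered by the head of l, run on the
-- tail of l, returns r.  A Π₂ sentence demands that each such token be backed by
-- the tokens of the immediate subcomputations.  Hence, if a program halts, all
-- its `eval` tokens carry the right result; conversely the derivation of a halting
-- run yields finitely many tokens, and these form a model once every other token
-- is put at ⊥.  So the sentence "f returns 0 on input x" is unsatisfiable when f
-- returns 1 on x and satisfiable when f returns 0.
--
-- The input enters only through free color variables z₀ , … , zₓ forced to be
-- 0 , … , x, so the code of the whole sentence is a computable function of x and of
-- the code of the part depending on f alone.  Given a decider r, let f map a code c
-- to the value of r on the sentence formed from the part coded by c and the input c.
-- Applied to the code of its own part, f contradicts r.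

open import Defs
open import Data.Fin using (Fin; zero; suc)
import Data.Fin.Properties as Fin
open import Data.List using (List; []; _∷_)
open import Data.List.Membership.Propositional using (_∈_)
open import Data.List.Relation.Unary.Any using (here; there)
open import Data.Maybe using (Maybe; just; nothing)
import Data.Maybe.Properties as Maybe
open import Data.Nat using (ℕ; zero; suc; _+_; _∸_; _≤_; _<_; _≟_; _≤?_; _<?_; z≤n; s≤s; s≤s⁻¹)
open import Data.Nat.Properties
open import Data.Product using (_×_; _,_; proj₁; proj₂; ∃-syntax; Σ-syntax)
open import Data.Sum using (_⊎_; inj₁; inj₂)
open import Data.Unit using (⊤; tt)
open import Data.Vec using (Vec; []; _∷_; lookup)
open import Data.Vec.Relation.Binary.Pointwise.Inductive using (Pointwise; []; _∷_)
open import Function using (_∘_; id)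
open import Relation.Binary.Definitions using (tri<; tri≈; tri>)
open import Relation.Binary.PropositionalEquality
open import Relation.Nullary using (¬_; Dec; yes; no; contradiction)
open import Relation.Nullary.Decidable using (_×-dec_; _⊎-dec_; _→-dec_; decidable-stable)

-- Injectivity of Cantor pairing.

triangle-mono : ∀ {m n} → m ≤ n → triangle m ≤ triangle n
triangle-mono z≤n       = z≤n
triangle-mono (s≤s m≤n) = +-mono-≤ (s≤s m≤n) (triangle-mono m≤n)

-- The gap between consecutive triangular numbers exceeds `b`, so a code stays below all codes on
-- later antidiagonals.
pair-<-diagonal : ∀ a b c d → a + b < c + d → pair a b < pair c d
pair-<-diagonal a b c d lt = begin-strict
  triangle (a + b) + b       ≡⟨ +-comm (triangle (a + b)) b ⟩
  b + triangle (a + b)       <⟨ s≤s (+-monoˡ-≤ (triangle (a + b)) (m≤n+m b a)) ⟩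
  triangle (suc (a + b))     ≤⟨ triangle-mono lt ⟩
  triangle (c + d)           ≤⟨ m≤m+n (triangle (c + d)) d ⟩
  triangle (c + d) + d       ∎
  where open ≤-Reasoning

pair-injective : ∀ a b c d → pair a b ≡ pair c d → a ≡ c × b ≡ d
pair-injective a b c d eq with <-cmp (a + b) (c + d)
... | tri< lt _ _ = contradiction eq (<⇒≢ (pair-<-diagonal a b c d lt))
... | tri> _ _ gt = contradiction (sym eq) (<⇒≢ (pair-<-diagonal c d a b gt))
... | tri≈ _ s _  = +-cancelʳ-≡ b a c (trans s (cong (c +_) (sym b≡d))) , b≡d
  where
  b≡d : b ≡ d
  b≡d = +-cancelˡ-≡ (triangle (a + b)) b d
          (trans eq (cong (λ n → triangle n + d) (sym s)))

-- Quantifier-free conditions.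

open CML≤ 4

pattern evalᴾ = zero
pattern headᴾ = suc zero
pattern tailᴾ = suc (suc zero)
pattern succᴾ = suc (suc (suc zero))

δ₁ δ₂ : ℕ → Term
δ₁ = δ zero
δ₂ = δ (suc zero)

0ᵀ : Term
0ᵀ = op tt []

infix  7 _∈ᴾ_ _≈_ _≲_ _≺_
infixr 6 _∧_
infixr 5 _∨_
infixr 4 _⇒_

-- Formulas have only negation and disjunction. Conditions also have conjunction, implication and
-- color equality, so that `Holds` can interpret them by Agda's own connectives.
data Condition : Set where
  top         : Condition
  _∈ᴾ_        : ℕ → Fin 4 → Condition
  _≈_ _≲_ _≺_ : Term → Term → Condition
  _∧_ _∨_ _⇒_ : Condition → Condition → Condition

leq : Term → Term → Formula
leq s t = rel tt (s ∷ t ∷ [])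

infixr 6 _∧′_

_∧′_ : Formula → Formula → Formula
φ ∧′ ψ = ¬′ (¬′ φ ∨′ ¬′ ψ)

toFormula : Condition → Formula
toFormula top      = true
toFormula (x ∈ᴾ p) = at (just p) x
toFormula (s ≈ t)  = leq s t ∧′ leq t s
toFormula (s ≲ t)  = leq s t
toFormula (s ≺ t)  = ¬′ leq t s
toFormula (φ ∧ ψ)  = toFormula φ ∧′ toFormula ψ
toFormula (φ ∨ ψ)  = toFormula φ ∨′ toFormula ψ
toFormula (φ ⇒ ψ)  = ¬′ toFormula φ ∨′ toFormula ψ

quantifierFree : ∀ φ → QuantifierFree (toFormula φ)
quantifierFree top      = true
quantifierFree (x ∈ᴾ p) = at (just p) x
quantifierFree (s ≈ t)  = ¬′ (¬′ rel tt _ ∨′ ¬′ rel tt _)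
quantifierFree (s ≲ t)  = rel tt _
quantifierFree (s ≺ t)  = ¬′ rel tt _
quantifierFree (φ ∧ ψ)  = ¬′ (¬′ quantifierFree φ ∨′ ¬′ quantifierFree ψ)
quantifierFree (φ ∨ ψ)  = quantifierFree φ ∨′ quantifierFree ψ
quantifierFree (φ ⇒ ψ)  = ¬′ quantifierFree φ ∨′ quantifierFree ψ

module _ (M : Marking) (θ ν : ℕ → ℕ) where

  private
    ⟪_⟫ : Term → ℕ
    ⟪ t ⟫ = ⟦_⟧ M t θ ν

  Holds : Condition → Set
  Holds top      = ⊤
  Holds (x ∈ᴾ p) = place M (θ x) ≡ just p
  Holds (s ≈ t)  = ⟪ s ⟫ ≡ ⟪ t ⟫
  Holds (s ≲ t)  = ⟪ s ⟫ ≤ ⟪ t ⟫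
  Holds (s ≺ t)  = ⟪ s ⟫ < ⟪ t ⟫
  Holds (φ ∧ ψ)  = Holds φ × Holds ψ
  Holds (φ ∨ ψ)  = Holds φ ⊎ Holds ψ
  Holds (φ ⇒ ψ)  = Holds φ → Holds ψ

  -- Decidability strips the double negations that the De Morgan translation introduces.
  holds? : ∀ φ → Dec (Holds φ)
  holds? top      = yes tt
  holds? (x ∈ᴾ p) = Maybe.≡-dec Fin._≟_ _ _
  holds? (s ≈ t)  = _ ≟ _
  holds? (s ≲ t)  = _ ≤? _
  holds? (s ≺ t)  = _ <? _
  holds? (φ ∧ ψ)  = holds? φ ×-dec holds? ψ
  holds? (φ ∨ ψ)  = holds? φ ⊎-dec holds? ψ
  holds? (φ ⇒ ψ)  = holds? φ →-dec holds? ψ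

  mutual
    models⇒holds : ∀ φ → Models M θ ν (toFormula φ) → Holds φ
    models⇒holds top      _        = tt
    models⇒holds (x ∈ᴾ p) m        = m
    models⇒holds (s ≈ t)  m        = ≤-antisym
      (decidable-stable (_ ≤? _) (m ∘ inj₁)) (decidable-stable (_ ≤? _) (m ∘ inj₂))
    models⇒holds (s ≲ t)  m        = m
    models⇒holds (s ≺ t)  m        = ≰⇒> m
    models⇒holds (φ ∧ ψ)  m        =
        decidable-stable (holds? φ) (λ n → m (inj₁ (n ∘ models⇒holds φ)))
      , decidable-stable (holds? ψ) (λ n → m (inj₂ (n ∘ models⇒holds ψ)))
    models⇒holds (φ ∨ ψ)  (inj₁ m) = inj₁ (models⇒holds φ m)
    models⇒holds (φ ∨ ψ)  (inj₂ m) = inj₂ (models⇒holds ψ m)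
    models⇒holds (φ ⇒ ψ)  (inj₁ n) = λ h → contradiction (holds⇒models φ h) n
    models⇒holds (φ ⇒ ψ)  (inj₂ m) = λ _ → models⇒holds ψ m

    holds⇒models : ∀ φ → Holds φ → Models M θ ν (toFormula φ)
    holds⇒models top      _        = tt
    holds⇒models (x ∈ᴾ p) h        = h
    holds⇒models (s ≈ t)  h        = λ { (inj₁ n) → n (≤-reflexive h)
                                       ; (inj₂ n) → n (≤-reflexive (sym h)) }
    holds⇒models (s ≲ t)  h        = h
    holds⇒models (s ≺ t)  h        = <⇒≱ h
    holds⇒models (φ ∧ ψ)  (h , k)  = λ { (inj₁ n) → n (holds⇒models φ h)
                                       ; (inj₂ n) → n (holds⇒models ψ k) }
    holds⇒models (φ ∨ ψ)  (inj₁ h) = inj₁ (holds⇒models φ h)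
    holds⇒models (φ ∨ ψ)  (inj₂ h) = inj₂ (holds⇒models ψ h)
    holds⇒models (φ ⇒ ψ)  h with holds? φ
    ... | yes p = inj₂ (holds⇒models ψ (h p))
    ... | no ¬p = inj₁ (¬p ∘ models⇒holds φ)

-- Quantifier prefixes

exists : (ℕ → Var) → (s k : ℕ) → Formula → Formula
exists V s zero    φ = φ
exists V s (suc k) φ = ∃′ (V s) (exists V (suc s) k φ)

exists-block : ∀ V s k {F φ} → Block ∃′ F φ → Block ∃′ F (exists V s k φ)
exists-block V s zero    b = b
exists-block V s (suc k) b = quant (V s) (exists-block V (suc s) k b)

-- The updates come in the order in which `Models` opens the prefix, so the two agree by
-- computation.
assign : (s k : ℕ) → (ℕ → ℕ) → (ℕ → ℕ) → (ℕ → ℕ)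
assign s zero    ys ρ = ρ
assign s (suc k) ys ρ = assign (suc s) k (ys ∘ suc) (ρ [ s ↦ ys 0 ])

_◂_ : ℕ → (ℕ → ℕ) → (ℕ → ℕ)
(y ◂ ys) zero    = y
(y ◂ ys) (suc n) = ys n

module _ (M : Marking) (φ : Formula) where

  exists-tok-intro : ∀ s k ys θ ν → Models M (assign s k ys θ) ν φ →
                     Models M θ ν (exists tok s k φ)
  exists-tok-intro s zero    ys θ ν m = m
  exists-tok-intro s (suc k) ys θ ν m =
    ys 0 , exists-tok-intro (suc s) k (ys ∘ suc) (θ [ s ↦ ys 0 ]) ν m

  exists-col-intro : ∀ s k ys θ ν → Models M θ (assign s k ys ν) φ →
                     Models M θ ν (exists col s k φ)
  exists-col-intro s zero    ys θ ν m = m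
  exists-col-intro s (suc k) ys θ ν m =
    ys 0 , exists-col-intro (suc s) k (ys ∘ suc) θ (ν [ s ↦ ys 0 ]) m

  exists-tok-elim : ∀ s k θ ν → Models M θ ν (exists tok s k φ) →
                    ∃[ ys ] Models M (assign s k ys θ) ν φ
  exists-tok-elim s zero    θ ν m       = id , m
  exists-tok-elim s (suc k) θ ν (y , m) =
    let ys , m′ = exists-tok-elim (suc s) k (θ [ s ↦ y ]) ν m in y ◂ ys , m′

  exists-col-elim : ∀ s k θ ν → Models M θ ν (exists col s k φ) →
                    ∃[ ys ] Models M θ (assign s k ys ν) φ
  exists-col-elim s zero    θ ν m       = id , m
  exists-col-elim s (suc k) θ ν (y , m) =
    let ys , m′ = exists-col-elim (suc s) k θ (ν [ s ↦ y ]) m in y ◂ ys , m′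

-- The universal variables are the color w (col 0) and the tokens x, x′ (tok 0, tok 1).
-- Token variables from 19 on and color variables from 14 on remain free.
closure : Formula → Formula
closure φ = ∀′ (col 0) (∀′ (tok 0) (∀′ (tok 1) (exists tok 2 17 (exists col 1 13 φ))))

closure-Π₂ : ∀ {φ} → QuantifierFree φ → IsΠ 2 (closure φ)
closure-Π₂ q = quant (col 0) (quant (tok 0) (quant (tok 1) (body
  (exists-block tok 2 17 (exists-block col 1 13 (body (matrix q)))))))

module _ (M : Marking) (θ ν : ℕ → ℕ) (φ : Condition) where

  Witnessed : (w x x′ : ℕ) → Set
  Witnessed w x x′ = ∃[ ys ] ∃[ cs ]
    Holds M (assign 2 17 ys (θ [ 0 ↦ x ] [ 1 ↦ x′ ])) (assign 1 13 cs (ν [ 0 ↦ w ])) φ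

  closure-intro : (∀ w x x′ → Witnessed w x x′) → Models M θ ν (closure (toFormula φ))
  closure-intro h (w , n) = n λ { (x , n) → n λ { (x′ , n) →
    let ys , cs , m = h w x x′
        θ₂ = θ [ 0 ↦ x ] [ 1 ↦ x′ ]
        ν₁ = ν [ 0 ↦ w ]
        m′ = holds⇒models M (assign 2 17 ys θ₂) (assign 1 13 cs ν₁) φ m
    in n (exists-tok-intro M (exists col 1 13 (toFormula φ)) 2 17 ys θ₂ ν₁
           (exists-col-intro M (toFormula φ) 1 13 cs (assign 2 17 ys θ₂) ν₁ m′)) } }

  -- `∀′` abbreviates `¬ ∃ ¬`, and an unbounded search for a witness has no decision procedure to
  -- remove the negations.
  closure-elim : Models M θ ν (closure (toFormula φ)) → ∀ w x x′ → ¬ ¬ Witnessed w x x′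
  closure-elim m w x x′ n = m (w , λ m → m (x , λ m → m (x′ , λ m →
    let θ₂ = θ [ 0 ↦ x ] [ 1 ↦ x′ ]
        ν₁ = ν [ 0 ↦ w ]
        ys , m₁ = exists-tok-elim M (exists col 1 13 (toFormula φ)) 2 17 θ₂ ν₁ m
        cs , m₂ = exists-col-elim M (toFormula φ) 1 13 (assign 2 17 ys θ₂) ν₁ m₁
    in n (ys , cs , models⇒holds M (assign 2 17 ys θ₂) (assign 1 13 cs ν₁) φ m₂))))

-- Programs as instructions

-- Parameters are the numbers of subprograms; `tailᴵ i` runs i on the tail of its
-- argument list, and `consᴵ i j` builds the list of results of a vector of programs.
data Instruction : Set where
  zeroᴵ sucᴵ headᴵ nilᴵ : Instruction
  tailᴵ minᴵ            : ℕ → Instruction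
  compᴵ consᴵ primᴵ     : ℕ → ℕ → Instruction

triple : Instruction → ℕ × ℕ × ℕ
triple zeroᴵ       = 0 , 0 , 0
triple sucᴵ        = 1 , 0 , 0
triple headᴵ       = 2 , 0 , 0
triple nilᴵ        = 3 , 0 , 0
triple (tailᴵ i)   = 4 , i , 0
triple (minᴵ i)    = 5 , i , 0
triple (compᴵ i j) = 6 , i , j
triple (consᴵ i j) = 7 , i , j
triple (primᴵ i j) = 8 , i , j

decode : ℕ × ℕ × ℕ → Instruction
decode (0 , _ , _) = zeroᴵ
decode (1 , _ , _) = sucᴵ
decode (2 , _ , _) = headᴵ
decode (3 , _ , _) = nilᴵ
decode (4 , i , _) = tailᴵ i
decode (5 , i , _) = minᴵ i
decode (6 , i , j) = compᴵ i j
decode (7 , i , j) = consᴵ i j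
decode (_ , i , j) = primᴵ i j

decode-triple : ∀ s → decode (triple s) ≡ s
decode-triple zeroᴵ       = refl
decode-triple sucᴵ        = refl
decode-triple headᴵ       = refl
decode-triple nilᴵ        = refl
decode-triple (tailᴵ i)   = refl
decode-triple (minᴵ i)    = refl
decode-triple (compᴵ i j) = refl
decode-triple (consᴵ i j) = refl
decode-triple (primᴵ i j) = refl

abstract
  encode : Instruction → ℕ
  encode s = let t , i , j = triple s in pair t (pair i j)

  encode-injective : ∀ {s s′} → encode s ≡ encode s′ → s ≡ s′
  encode-injective {s} {s′} eq =
    let t≡ , p≡ = pair-injective (proj₁ (triple s)) _ (proj₁ (triple s′)) _ eq
        i≡ , j≡ = pair-injective (proj₁ (proj₂ (triple s))) _ (proj₁ (proj₂ (triple s′))) _ p≡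
    in trans (sym (decode-triple s))
         (trans (cong decode (cong₂ _,_ t≡ (cong₂ _,_ i≡ j≡))) (decode-triple s′))

mutual
  instruction : ∀ {n} → Rec n → Instruction
  instruction zeroᴿ       = zeroᴵ
  instruction sucᴿ        = sucᴵ
  instruction (proj i)    = instructionᴾ i
  instruction (comp f gs) = compᴵ (number f) (numberᵛ gs)
  instruction (prim g h)  = primᴵ (number g) (number h)
  instruction (min f)     = minᴵ (number f)

  -- An entry of a list is the head of an iterated tail, so a projection becomes a chain of one-step
  -- instructions.
  instructionᴾ : ∀ {n} → Fin n → Instruction
  instructionᴾ zero    = headᴵ
  instructionᴾ (suc i) = tailᴵ (encode (instructionᴾ i))

  instructionᵛ : ∀ {m n} → Vec (Rec n) m → Instruction
  instructionᵛ []       = nilᴵ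
  instructionᵛ (g ∷ gs) = consᴵ (number g) (numberᵛ gs)

  number : ∀ {n} → Rec n → ℕ
  number f = encode (instruction f)

  numberᵛ : ∀ {m n} → Vec (Rec n) m → ℕ
  numberᵛ gs = encode (instructionᵛ gs)

-- Justified evaluation tokens.

Structure : Set₁
Structure = Fin 4 → ℕ → ℕ → Set

Cell : Structure → ℕ → ℕ → ℕ → Set
Cell F l h t = F headᴾ l h × F tailᴾ l t

Call : Structure → ℕ → ℕ → ℕ → Set
Call F i a r = ∃[ l ] F evalᴾ l r × Cell F l i a

-- ι assigns to the number of a subprogram the color that stands for it.
Justified : Structure → (ℕ → ℕ) → ℕ → Instruction → ℕ → ℕ → Set
Justified F ι w zeroᴵ a r = r ≡ 0
Justified F ι w sucᴵ  a r = ∃[ v ] F headᴾ a v × F succᴾ v r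
Justified F ι w headᴵ a r = F headᴾ a r
-- Every color may stand for the empty list.
Justified F ι w nilᴵ  a r = ⊤
Justified F ι w (tailᴵ i) a r = ∃[ t ] F tailᴾ a t × Call F (ι i) t r
Justified F ι w (minᴵ i) a r = ∃[ l ] Cell F l r a × Call F (ι i) l 0 ×
  -- The universally quantified `w` runs through the candidates below `r`: a bounded quantifier
  -- without a further alternation.
  (w < r → ∃[ l′ ] ∃[ v ] Cell F l′ w a × Call F (ι i) l′ v × 0 < v)
Justified F ι w (compᴵ i j) a r = ∃[ y ] Call F (ι j) a y × Call F (ι i) y r
Justified F ι w (consᴵ i j) a r =
  ∃[ y ] ∃[ ys ] Call F (ι i) a y × Call F (ι j) a ys × Cell F r y ys
Justified F ι w (primᴵ i j) a r = ∃[ k ] ∃[ t ] Cell F a k t ×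
  ( k ≡ 0 × Call F (ι i) t r
  -- `l₁` is the list k′ ∷ t of the recursive call with value `y`; `l₂` is k′ ∷ y ∷ t, with tail
  -- `l₃`.
  ⊎ (∃[ k′ ] ∃[ y ] ∃[ l₁ ] ∃[ l₂ ] ∃[ l₃ ] F succᴾ k′ k ×
      Cell F l₁ k′ t × Call F (ι (encode (primᴵ i j))) l₁ y ×
      Cell F l₂ k′ l₃ × Cell F l₃ y t × Call F (ι j) l₂ r))

-- A token condition takes one token variable, a cell two and a call three, all consecutive; this
-- fixes the numbering in `justified`.
token : Fin 4 → ℕ → Term → Term → Condition
token p x s t = x ∈ᴾ p ∧ δ₁ x ≈ s ∧ δ₂ x ≈ t

cell : ℕ → Term → Term → Term → Condition
cell x l h t = token headᴾ x l h ∧ token tailᴾ (1 + x) l t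

call : ℕ → Term → Term → Term → Term → Condition
call x l i a r = token evalᴾ x l r ∧ cell (1 + x) l i a

-- Free color variable standing for the number k.
index : ℕ → Term
index k = var (16 + k)

-- The color variables 1 to 4 hold the colors of the token x, the program number and
-- the argument list; tokens 2 and 3 are the cell of the latter two.
justified : Instruction → Condition
justified = go
  where
  w = var 0
  r = var 2
  a = var 4

  go : Instruction → Condition
  go zeroᴵ = r ≈ 0ᵀ
  go sucᴵ  = token headᴾ 4 a (var 5) ∧ token succᴾ 5 (var 5) r
  go headᴵ = token headᴾ 4 a r
  go nilᴵ  = top
  go (tailᴵ i) = token tailᴾ 4 a (var 5) ∧ call 5 (var 6) (index i) (var 5) r
  go (minᴵ i) =
    cell 4 (var 5) r a ∧ call 6 (var 6) (index i) (var 5) 0ᵀ ∧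
    (w ≺ r ⇒ cell 9 (var 7) w a ∧ call 11 (var 8) (index i) (var 7) (var 9) ∧ 0ᵀ ≺ var 9)
  go (compᴵ i j) =
    call 4 (var 6) (index j) a (var 5) ∧ call 7 (var 7) (index i) (var 5) r
  go (consᴵ i j) =
    call 4 (var 7) (index i) a (var 5) ∧ call 7 (var 8) (index j) a (var 6) ∧
    cell 10 r (var 5) (var 6)
  go (primᴵ i j) =
    cell 4 a (var 5) (var 6) ∧
    ( var 5 ≈ 0ᵀ ∧ call 6 (var 7) (index i) (var 6) r
    ∨ token succᴾ 6 (var 7) (var 5) ∧
      cell 7 (var 9) (var 7) (var 6) ∧
      call 9 (var 12) (index (encode (primᴵ i j))) (var 9) (var 8) ∧
      cell 12 (var 10) (var 7) (var 11) ∧ cell 14 (var 11) (var 8) (var 6) ∧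
      -- The largest clause ends with token 18 and color 13. The prefix of `closure`, tokens 2 to 18
      -- and colors 1 to 13, is sized for it.
      call 16 (var 13) (index j) (var 10) r)

structure : Marking → Structure
structure M p a b = ∃[ t ] place M t ≡ just p × color M zero t ≡ a × color M (suc zero) t ≡ b

values : List ℕ → ℕ → ℕ
values []       _       = 0
values (y ∷ ys) zero    = y
values (y ∷ ys) (suc n) = values ys n

module _ (M : Marking) where

  private
    F = structure M

  holds⇒Justified : ∀ θ ν s → Holds M θ ν (justified s) →
                    Justified F (λ k → ν (16 + k)) (ν 0) s (ν 4) (ν 2)
  holds⇒Justified θ ν zeroᴵ h = h
  holds⇒Justified θ ν sucᴵ (h , k) = _ , (_ , h) , (_ , k)
  holds⇒Justified θ ν headᴵ h = _ , h
  holds⇒Justified θ ν nilᴵ _ = tt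
  holds⇒Justified θ ν (tailᴵ i) (h , c , d , e) = _ , (_ , h) , _ , (_ , c) , (_ , d) , (_ , e)
  holds⇒Justified θ ν (minᴵ i) ((c , d) , (e , f , g) , h) =
    _ , ((_ , c) , (_ , d)) , (_ , (_ , e) , (_ , f) , (_ , g)) , λ lt →
    let (c′ , d′) , (e′ , f′ , g′) , pos = h lt
    in _ , _ , ((_ , c′) , (_ , d′)) , (_ , (_ , e′) , (_ , f′) , (_ , g′)) , pos
  holds⇒Justified θ ν (compᴵ i j) ((c , d , e) , (c′ , d′ , e′)) =
    _ , (_ , (_ , c) , (_ , d) , (_ , e)) , (_ , (_ , c′) , (_ , d′) , (_ , e′))
  holds⇒Justified θ ν (consᴵ i j) ((c , d , e) , (c′ , d′ , e′) , (f , g)) =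
    _ , _ , (_ , (_ , c) , (_ , d) , (_ , e)) , (_ , (_ , c′) , (_ , d′) , (_ , e′)) ,
    ((_ , f) , (_ , g))
  holds⇒Justified θ ν (primᴵ i j) ((f , g) , inj₁ (z , c , d , e)) =
    _ , _ , ((_ , f) , (_ , g)) , inj₁ (z , _ , (_ , c) , (_ , d) , (_ , e))
  holds⇒Justified θ ν (primᴵ i j)
    ((f , g) , inj₂ (s , (f₁ , g₁) , (c , d , e) , (f₂ , g₂) , (f₃ , g₃) , (c′ , d′ , e′))) =
    _ , _ , ((_ , f) , (_ , g)) , inj₂ (_ , _ , _ , _ , _ , (_ , s) ,
      ((_ , f₁) , (_ , g₁)) , (_ , (_ , c) , (_ , d) , (_ , e)) ,
      ((_ , f₂) , (_ , g₂)) , ((_ , f₃) , (_ , g₃)) , (_ , (_ , c′) , (_ , d′) , (_ , e′)))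

  Justified⇒holds : ∀ θ ν t₂ t₃ l r i a s →
    Justified F (λ k → ν (16 + k)) (ν 0) s a r →
    ∃[ ts ] ∃[ cs ] Holds M (assign 2 17 (values (t₂ ∷ t₃ ∷ ts)) θ)
                            (assign 1 13 (values (l ∷ r ∷ i ∷ a ∷ cs)) ν) (justified s)
  Justified⇒holds θ ν t₂ t₃ l r i a zeroᴵ h = [] , [] , h
  Justified⇒holds θ ν t₂ t₃ l r i a sucᴵ (v , (_ , h) , (_ , k)) = (_ ∷ _ ∷ []) , v ∷ [] , h , k
  Justified⇒holds θ ν t₂ t₃ l r i a headᴵ (_ , h) = (_ ∷ []) , [] , h
  Justified⇒holds θ ν t₂ t₃ l r i a nilᴵ _ = [] , [] , tt
  Justified⇒holds θ ν t₂ t₃ l r i a (tailᴵ _) (t , (x , h) , l′ , (y , c) , (y′ , d) , (y″ , e)) =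
    (x ∷ y ∷ y′ ∷ y″ ∷ []) , (t ∷ l′ ∷ []) , h , c , d , e
  Justified⇒holds θ ν t₂ t₃ l r i a (minᴵ _)
    -- In prenex form the witnesses stand before the implication, so `w < r` is decided before they
    -- are chosen.
    (l₁ , ((x₁ , c) , (x₂ , d)) , (l₂ , (x₃ , e) , (x₄ , f) , (x₅ , g)) , h) with ν 0 <? r
  ... | no ≮ = (x₁ ∷ x₂ ∷ x₃ ∷ x₄ ∷ x₅ ∷ []) , (l₁ ∷ l₂ ∷ []) ,
               (c , d) , (e , f , g) , λ lt → contradiction lt ≮
  ... | yes lt with h lt
  ...   | l₃ , v , ((y₁ , c′) , (y₂ , d′)) , (l₄ , (y₃ , e′) , (y₄ , f′) , (y₅ , g′)) , pos =
    (x₁ ∷ x₂ ∷ x₃ ∷ x₄ ∷ x₅ ∷ y₁ ∷ y₂ ∷ y₃ ∷ y₄ ∷ y₅ ∷ []) , (l₁ ∷ l₂ ∷ l₃ ∷ l₄ ∷ v ∷ []) ,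
    (c , d) , (e , f , g) , λ _ → (c′ , d′) , (e′ , f′ , g′) , pos
  Justified⇒holds θ ν t₂ t₃ l r i a (compᴵ _ _)
    (y , (l₁ , (x₁ , c) , (x₂ , d) , (x₃ , e)) , (l₂ , (x₄ , c′) , (x₅ , d′) , (x₆ , e′))) =
    (x₁ ∷ x₂ ∷ x₃ ∷ x₄ ∷ x₅ ∷ x₆ ∷ []) , (y ∷ l₁ ∷ l₂ ∷ []) , (c , d , e) , (c′ , d′ , e′)
  Justified⇒holds θ ν t₂ t₃ l r i a (consᴵ _ _)
    (y , ys , (l₁ , (x₁ , c) , (x₂ , d) , (x₃ , e)) , (l₂ , (x₄ , c′) , (x₅ , d′) , (x₆ , e′)) ,
     ((x₇ , f) , (x₈ , g))) =
    (x₁ ∷ x₂ ∷ x₃ ∷ x₄ ∷ x₅ ∷ x₆ ∷ x₇ ∷ x₈ ∷ []) , (y ∷ ys ∷ l₁ ∷ l₂ ∷ []) ,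
    (c , d , e) , (c′ , d′ , e′) , (f , g)
  Justified⇒holds θ ν t₂ t₃ l r i a (primᴵ _ _)
    (k , t , ((x₁ , f) , (x₂ , g)) , inj₁ (z , l₁ , (x₃ , c) , (x₄ , d) , (x₅ , e))) =
    (x₁ ∷ x₂ ∷ x₃ ∷ x₄ ∷ x₅ ∷ []) , (k ∷ t ∷ l₁ ∷ []) , (f , g) , inj₁ (z , c , d , e)
  Justified⇒holds θ ν t₂ t₃ l r i a (primᴵ _ _)
    (k , t , ((x₁ , f) , (x₂ , g)) , inj₂ (k′ , y , l₁ , l₂ , l₃ , (x₃ , s) ,
      ((x₄ , f₁) , (x₅ , g₁)) , (l₄ , (x₆ , c) , (x₇ , d) , (x₈ , e)) ,
      ((x₉ , f₂) , (x₁₀ , g₂)) , ((x₁₁ , f₃) , (x₁₂ , g₃)) ,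
      (l₅ , (x₁₃ , c′) , (x₁₄ , d′) , (x₁₅ , e′)))) =
    (x₁ ∷ x₂ ∷ x₃ ∷ x₄ ∷ x₅ ∷ x₆ ∷ x₇ ∷ x₈ ∷ x₉ ∷ x₁₀ ∷ x₁₁ ∷ x₁₂ ∷ x₁₃ ∷ x₁₄ ∷ x₁₅ ∷ []) ,
    (k ∷ t ∷ k′ ∷ y ∷ l₁ ∷ l₂ ∷ l₃ ∷ l₄ ∷ l₅ ∷ []) ,
    (f , g) , inj₂ (s , (f₁ , g₁) , (c , d , e) , (f₂ , g₂) , (f₃ , g₃) , (c′ , d′ , e′))

-- The sentence for a program and an input.

node : Instruction → Condition
node s = var 3 ≈ index (encode s) ⇒ justified s

mutual
  nodes : ∀ {n} → Rec n → Condition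
  nodes zeroᴿ         = node zeroᴵ
  nodes sucᴿ          = node sucᴵ
  nodes (proj i)      = nodesᴾ i
  nodes (comp f gs)   = node (instruction (comp f gs)) ∧ nodes f ∧ nodesᵛ gs
  nodes (prim g h)    = node (instruction (prim g h)) ∧ nodes g ∧ nodes h
  nodes (min f)       = node (instruction (min f)) ∧ nodes f

  nodesᴾ : ∀ {n} → Fin n → Condition
  nodesᴾ zero    = node headᴵ
  nodesᴾ (suc i) = node (instructionᴾ (suc i)) ∧ nodesᴾ i

  nodesᵛ : ∀ {m n} → Vec (Rec n) m → Condition
  nodesᵛ []       = node nilᴵ
  nodesᵛ (g ∷ gs) = node (instructionᵛ (g ∷ gs)) ∧ nodes g ∧ nodesᵛ gs

-- Expresses t = s + 1 because the color w (var 0) is universally quantified.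
adjacent : Term → Term → Condition
adjacent s t = s ≺ t ∧ (var 0 ≲ s ∨ t ≲ var 0)

-- The second universal token `x′` is quantified for the sake of this condition.
functional : Fin 4 → Condition
functional p = 0 ∈ᴾ p ∧ 1 ∈ᴾ p ∧ δ₁ 0 ≈ δ₁ 1 ⇒ δ₂ 0 ≈ δ₂ 1

-- One existential block serves all nodes, since at most one node matches the
-- program number of the token x.
program : Rec 1 → Condition
program f =
  (0 ∈ᴾ succᴾ ⇒ adjacent (δ₁ 0) (δ₂ 0)) ∧ functional headᴾ ∧ functional tailᴾ ∧
  (0 ∈ᴾ evalᴾ ⇒ token evalᴾ 0 (var 1) (var 2) ∧ cell 2 (var 1) (var 3) (var 4) ∧ nodes f) ∧
  -- Free tokens 19 to 21 and colors 14 and 15 claim that `f` returns 0 on the list named by color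
  -- 15; `input` ties the head of that list to the input.
  call 19 (var 14) (index (number f)) (var 15) 0ᵀ

-- Numerals are built by successors from the only constant, by a recursion that stays primitive
-- recursive on codes.
pinned : ℕ → Condition
pinned zero    = index 0 ≲ 0ᵀ
pinned (suc k) = adjacent (index k) (index (suc k)) ∧ pinned k

input : ℕ → Condition
input x = token headᴾ 22 (var 15) (index x) ∧ pinned x

sentence : Rec 1 → ℕ → Formula
sentence f x = closure (toFormula (program f ∧ input x))

-- Soundness: results in an arbitrary model.

adjacent⇒suc : ∀ {a b} → a < b → suc a ≤ a ⊎ b ≤ suc a → b ≡ suc a
adjacent⇒suc a<b (inj₁ le) = contradiction le (<-irrefl refl)
adjacent⇒suc a<b (inj₂ le) = ≤-antisym le a<b

module Soundness (f₀ : Rec 1) (x₀ : ℕ) (M : Marking) (θ ν : ℕ → ℕ)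
                 (sat : Models M θ ν (sentence f₀ x₀)) where

  private
    F = structure M
    ι : ℕ → ℕ
    -- Colors of program numbers are whatever the model provides. Two instructions may share a
    -- color; a token with that color then satisfies both nodes.
    ι k = ν (16 + k)
    Matrix = program f₀ ∧ input x₀

  -- `closure-elim` yields doubly negated witnesses, so goals drawn from the model must be stable.
  using-witness : ∀ {G : Set} → (¬ ¬ G → G) →
                  ∀ w t t′ → (Witnessed M θ ν Matrix w t t′ → G) → G
  using-witness stable w t t′ k =
    stable (λ ¬G → closure-elim M θ ν Matrix sat w t t′ (¬G ∘ k))

  stable-≡ : {a b : ℕ} → ¬ ¬ a ≡ b → a ≡ b
  stable-≡ = decidable-stable (_ ≟ _)

  succ-sound : ∀ {a b} → F succᴾ a b → b ≡ suc a
  -- At w = a + 1 the disjunction in `adjacent` leaves only b ≤ a + 1.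
  succ-sound (t , p , refl , refl) = using-witness stable-≡ (suc (color M zero t)) t t
    λ { (_ , _ , (s , _) , _) → let a<b , c = s p in adjacent⇒suc a<b c }

  head-functional : ∀ {l a b} → F headᴾ l a → F headᴾ l b → a ≡ b
  head-functional (t , p , l≡ , refl) (t′ , p′ , l≡′ , refl) = using-witness stable-≡ 0 t t′
    λ { (_ , _ , (_ , h , _) , _) → h (p , p′ , trans l≡ (sym l≡′)) }

  tail-functional : ∀ {l a b} → F tailᴾ l a → F tailᴾ l b → a ≡ b
  tail-functional (t , p , l≡ , refl) (t′ , p′ , l≡′ , refl) = using-witness stable-≡ 0 t t′
    λ { (_ , _ , (_ , _ , h , _) , _) → h (p , p′ , trans l≡ (sym l≡′)) }

  -- The hypothesis stays open in `w`: each numeral is pinned by its own choice of `w`, and the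
  -- existential witnesses vary with it.
  pinned-sound : ∀ k → (∀ w → ¬ ¬ (∃[ θ′ ] ∃[ cs ]
                   Holds M θ′ (assign 1 13 cs (ν [ 0 ↦ w ])) (pinned k))) → ι k ≡ k
  pinned-sound zero    h =
    stable-≡ (λ ≢ → h 0 λ { (_ , _ , le) → ≢ (n≤0⇒n≡0 le) })
  pinned-sound (suc k) h = trans
    (stable-≡ (λ ≢ → h (suc (ι k)) λ { (_ , _ , (lt , c) , _) → ≢ (adjacent⇒suc lt c) }))
    (cong suc (pinned-sound k (λ w n → h w λ { (θ′ , cs , _ , m) → n (θ′ , cs , m) })))

  -- Nodes of a subprogram are conjuncts of `nodes f₀`. Stated for all valuations, this passes to
  -- subprograms by projections while the witnesses change.
  Entails : Condition → Set
  Entails φ = ∀ θ′ ν′ → Holds M θ′ ν′ (nodes f₀) → Holds M θ′ ν′ φ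

  -- Instantiating x by the `eval` token of the call yields witness tokens for its program and
  -- argument. Functionality of head and tail identifies their values with those of the call, so the
  -- guard of the node for `s` applies.
  justify : ∀ s {a r} {G : Set} → Entails (node s) → Call F (ι (encode s)) a r → (¬ ¬ G → G) →
            ∀ w → (Justified F ι w s a r → G) → G
  justify s {a} entails (l , (t , p , refl , refl) , h , tl) stable w k =
    using-witness stable w t t λ { (ys , cs , (_ , _ , _ , e , _) , _) →
      let (_ , l≡ , r≡) , (h′ , tl′) , ns = e p
          θ′ = assign 2 17 ys (θ [ 0 ↦ t ] [ 1 ↦ t ])
          ν′ = assign 1 13 cs (ν [ 0 ↦ w ])
          i≡ : cs 2 ≡ ι (encode s)
          i≡ = head-functional (_ , h′) (subst (λ l → F headᴾ l _) l≡ h)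
          a≡ : cs 3 ≡ a
          a≡ = tail-functional (_ , tl′) (subst (λ l → F tailᴾ l _) l≡ tl)
          j : Justified F ι w s (cs 3) (cs 1)
          j = holds⇒Justified M θ′ ν′ s (entails θ′ ν′ ns i≡)
      in k (subst₂ (Justified F ι w s) a≡ (sym r≡) j) }

  -- Stated negatively, so as to be stable under double negation.
  Represents : ∀ {n} → ℕ → Vec ℕ n → Set
  Represents a []       = ⊤
  Represents a (x ∷ xs) = (∀ {v} → F headᴾ a v → v ≡ x) × (∀ {t} → F tailᴾ a t → Represents t xs)

  stable-Represents : ∀ {n} {a} (xs : Vec ℕ n) → ¬ ¬ Represents a xs → Represents a xs
  stable-Represents []       _  = tt
  stable-Represents (x ∷ xs) ¬¬ =
      (λ h → stable-≡ (λ n → ¬¬ (λ m → n (proj₁ m h))))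
    , (λ t → stable-Represents xs (λ n → ¬¬ (λ m → n (proj₂ m t))))

  represents-∷ : ∀ {n l h t x} {xs : Vec ℕ n} → Cell F l h t → h ≡ x → Represents t xs →
                 Represents l (x ∷ xs)
  represents-∷ {xs = xs} (h , t) h≡x rep =
      (λ h′ → trans (head-functional h′ h) h≡x)
    , (λ t′ → subst (λ t → Represents t xs) (tail-functional t t′) rep)

  evaluateᴾ : ∀ {n a r} (i : Fin n) xs → Entails (nodesᴾ i) →
              Call F (ι (encode (instructionᴾ i))) a r → Represents a xs → r ≡ lookup xs i
  evaluateᴾ zero    (x ∷ xs) ent c rep = justify headᴵ ent c stable-≡ 0 (proj₁ rep)
  evaluateᴾ (suc i) (x ∷ xs) ent c rep =
    justify (instructionᴾ (suc i)) (λ _ _ → proj₁ ∘ ent _ _) c stable-≡ 0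
    λ { (t , tl , c′) → evaluateᴾ i xs (λ _ _ → proj₂ ∘ ent _ _) c′ (proj₂ rep tl) }

  mutual
    -- Induction on the derivation: subderivations force the results of the calls that justify the
    -- token.
    evaluate : ∀ {n a r} {f : Rec n} {xs z} → Entails (nodes f) → f [ xs ]⇓ z →
               Call F (ι (number f)) a r → Represents a xs → r ≡ z
    evaluate ent zero⇓ c rep = justify zeroᴵ ent c stable-≡ 0 id
    evaluate ent suc⇓ c rep = justify sucᴵ ent c stable-≡ 0
      λ { (v , h , s) → trans (succ-sound s) (cong suc (proj₁ rep h)) }
    evaluate ent (proj⇓ {i = i} {xs}) c rep = evaluateᴾ i xs ent c rep
    evaluate {f = f} ent (comp⇓ ds d) c rep =
      justify (instruction f) (λ _ _ → proj₁ ∘ ent _ _) c stable-≡ 0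
      λ { (y , cs , cf) → evaluate (λ _ _ → proj₁ ∘ proj₂ ∘ ent _ _) d cf
            (evaluateᵛ (λ _ _ → proj₂ ∘ proj₂ ∘ ent _ _) ds cs rep) }
    evaluate {f = f} ent (prim⇓-zero d) c rep =
      justify (instruction f) (λ _ _ → proj₁ ∘ ent _ _) c stable-≡ 0
      λ { (k , t , (h , tl) , inj₁ (_ , c′)) →
            evaluate (λ _ _ → proj₁ ∘ proj₂ ∘ ent _ _) d c′ (proj₂ rep tl)
        ; (k , t , (h , tl) , inj₂ (_ , _ , _ , _ , _ , s , _)) →
            contradiction (trans (sym (succ-sound s)) (proj₁ rep h)) (λ ()) }
    evaluate {f = f} ent (prim⇓-suc d e) c rep =
      justify (instruction f) (λ _ _ → proj₁ ∘ ent _ _) c stable-≡ 0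
      λ { (k , t , (h , tl) , inj₁ (k≡0 , _)) →
            contradiction (trans (sym k≡0) (proj₁ rep h)) (λ ())
        ; (k , t , (h , tl) , inj₂ (k′ , y , l₁ , l₂ , l₃ , s , x₁ , c₁ , x₂ , x₃ , c₂)) →
            let k≡ = suc-injective (trans (sym (succ-sound s)) (proj₁ rep h))
                y≡ = evaluate ent d c₁ (represents-∷ x₁ k≡ (proj₂ rep tl))
            in evaluate (λ _ _ → proj₂ ∘ proj₂ ∘ ent _ _) e c₂
                 (represents-∷ x₂ k≡ (represents-∷ x₃ y≡ (proj₂ rep tl))) }
    evaluate {r = r} {f = f} ent (min⇓ {k = k} d below) c rep =
      -- With w = k, a token whose result exceeds the true minimum `k` must testify about `k`.
      justify (instruction f) (λ _ _ → proj₁ ∘ ent _ _) c stable-≡ k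
      λ { (l , x , c₀ , positive) →
            evaluate-min (λ _ _ → proj₂ ∘ ent _ _) d below c₀ rep x positive }

    -- A smaller `r` contradicts the positive value that `below` gives at `r`; a larger one
    -- contradicts the value 0 at `k`.
    evaluate-min : ∀ {n a r l} {f : Rec (1 + n)} {xs k} → Entails (nodes f) →
      f [ k ∷ xs ]⇓ 0 → (∀ j → j < k → ∃[ v ] f [ j ∷ xs ]⇓ suc v) →
      Call F (ι (number f)) l 0 → Represents a xs → Cell F l r a →
      (k < r → ∃[ l′ ] ∃[ v ] Cell F l′ k a × Call F (ι (number f)) l′ v × 0 < v) → r ≡ k
    evaluate-min {r = r} {k = k} ent d below c₀ rep x positive with <-cmp r k
    ... | tri≈ _ r≡k _ = r≡k
    ... | tri< r<k _ _ =
      contradiction (evaluate ent (proj₂ (below r r<k)) c₀ (represents-∷ x refl rep)) (λ ())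
    ... | tri> _ _ k<r =
      let _ , v , x′ , c′ , 0<v = positive k<r
      in contradiction (sym (evaluate ent d c′ (represents-∷ x′ refl rep))) (<⇒≢ 0<v)

    evaluateᵛ : ∀ {m n a r} {gs : Vec (Rec n) m} {xs} {ys : Vec ℕ m} → Entails (nodesᵛ gs) →
                Pointwise (λ g y → g [ xs ]⇓ y) gs ys →
                Call F (ι (numberᵛ gs)) a r → Represents a xs → Represents r ys
    evaluateᵛ ent [] c rep = tt
    evaluateᵛ {gs = gs} {ys = ys} ent (d ∷ ds) c rep =
      justify (instructionᵛ gs) (λ _ _ → proj₁ ∘ ent _ _) c (stable-Represents ys) 0
      λ { (y , t , c₁ , c₂ , x) → represents-∷ x
            (evaluate (λ _ _ → proj₁ ∘ proj₂ ∘ ent _ _) d c₁ rep)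
            (evaluateᵛ (λ _ _ → proj₂ ∘ proj₂ ∘ ent _ _) ds c₂ rep) }

  result-zero : ∀ {z} → f₀ [ x₀ ∷ [] ]⇓ z → 0 ≡ z
  -- Any instance serves, since the root call and the head token of its argument mention only free
  -- variables.
  result-zero d = using-witness stable-≡ 0 0 0
    λ { (_ , _ , (_ , _ , _ , _ , e , h , t) , arg , _) →
      evaluate (λ _ _ → id) d (_ , (_ , e) , (_ , h) , (_ , t))
        ( (λ h′ → trans (head-functional h′ (_ , arg)) (pinned-sound x₀ λ w n →
             closure-elim M θ ν Matrix sat w 0 0 λ { (_ , cs , _ , _ , p) → n (_ , cs , p) }))
        , λ _ → tt) }

-- Finite sets of facts built from derivations.

infix  4 _⊑_
infixr 9 _⊙_

_⊑_ : Structure → Structure → Set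
F ⊑ G = ∀ p a b → F p a b → G p a b

_⊙_ : ∀ {F G H} → G ⊑ H → F ⊑ G → F ⊑ H
(g ⊙ f) p a b = g p a b ∘ f p a b

Fact : Set
Fact = Fin 4 × ℕ × ℕ

marking : List Fact → Marking
-- Tokens beyond the list lie at ⊥, where no guard on a place holds.
marking []                _       = nothing , 0 ∷ 0 ∷ []
marking ((p , a , b) ∷ L) zero    = just p , a ∷ b ∷ []
marking (_ ∷ L)           (suc t) = marking L t

members : List Fact → Structure
members L p a b = (p , a , b) ∈ L


members⇒structure : ∀ {L} → members L ⊑ structure (marking L)
members⇒structure _ _ _ (here refl) = 0 , refl , refl , refl
members⇒structure _ _ _ (there m)   = let t , h = members⇒structure _ _ _ m in suc t , h

place⇒∈ : ∀ L t {p} → place (marking L) t ≡ just p →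
          members L p (color (marking L) zero t) (color (marking L) (suc zero) t)
place⇒∈ (_ ∷ _) zero    refl = here refl
place⇒∈ (_ ∷ L) (suc t) eq   = there (place⇒∈ L t eq)

module _ {F G : Structure} (F⊑G : F ⊑ G) where

  private
    f : ∀ {p a b} → F p a b → G p a b
    f = F⊑G _ _ _

  Cell-map : ∀ {l h t} → Cell F l h t → Cell G l h t
  Cell-map (h , t) = f h , f t

  Call-map : ∀ {i a r} → Call F i a r → Call G i a r
  Call-map (l , e , c) = l , f e , Cell-map c

  -- `F` occurs only positively: the premise w < r of minimization does not mention it.
  Justified-map : ∀ {ι w} s {a r} → Justified F ι w s a r → Justified G ι w s a r
  Justified-map zeroᴵ h = h
  Justified-map sucᴵ (v , h , s) = v , f h , f s
  Justified-map headᴵ h = f h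
  Justified-map nilᴵ _ = tt
  Justified-map (tailᴵ _) (t , h , c) = t , f h , Call-map c
  Justified-map (minᴵ _) (l , x , c , k) = l , Cell-map x , Call-map c , λ lt →
    let l′ , v , x′ , c′ , pos = k lt in l′ , v , Cell-map x′ , Call-map c′ , pos
  Justified-map (compᴵ _ _) (y , c , d) = y , Call-map c , Call-map d
  Justified-map (consᴵ _ _) (y , ys , c , d , x) = y , ys , Call-map c , Call-map d , Cell-map x
  Justified-map (primᴵ _ _) (k , t , x , inj₁ (z , c)) = k , t , Cell-map x , inj₁ (z , Call-map c)
  Justified-map (primᴵ _ _) (k , t , x , inj₂ (_ , _ , _ , _ , _ , s , x₁ , c₁ , x₂ , x₃ , c₂)) =
    k , t , Cell-map x , inj₂ (_ , _ , _ , _ , _ , f s ,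
      Cell-map x₁ , Call-map c₁ , Cell-map x₂ , Cell-map x₃ , Call-map c₂)

-- Cells are Cantor pairs, so functionality will follow from injectivity of pairing. Program numbers
-- are their own colors, whence `id`.
Good : List Fact → Fact → Set
Good L (headᴾ , l , h) = ∃[ t ] l ≡ pair h t
Good L (tailᴾ , l , t) = ∃[ h ] l ≡ pair h t
Good L (succᴾ , a , b) = b ≡ suc a
Good L (evalᴾ , l , r) = ∃[ s ] ∃[ a ] Cell (members L) l (encode s) a ×
                         (∀ w → Justified (members L) id w s a r)

Good-mono : ∀ {L L′} f → members L ⊑ members L′ → Good L f → Good L′ f
Good-mono (headᴾ , _) _ g = g
Good-mono (tailᴾ , _) _ g = g
Good-mono (succᴾ , _) _ g = g
Good-mono (evalᴾ , _) sub (s , a , c , j) =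
  s , a , Cell-map sub c , λ w → Justified-map sub s (j w)

Closed : List Fact → Set
Closed L = ∀ {f} → f ∈ L → Good L f

-- Facts are only ever added, so what was justified stays so and subderivations can be treated one
-- after another.
record Extension (L : List Fact) (P : Structure → Set) : Set where
  constructor extension
  field
    {facts} : List Fact
    extends : members L ⊑ members facts
    closed  : Closed facts
    holds   : P (members facts)

skip : ∀ {f L} → members L ⊑ members (f ∷ L)
skip _ _ _ = there

add-fact : ∀ {L} f → Good (f ∷ L) f → Closed L → Closed (f ∷ L)
add-fact f g c (here refl) = g
add-fact f g c (there m)   = Good-mono _ skip (c m)

add-cell : ∀ {L} h t → Closed L → Extension L (λ F → Cell F (pair h t) h t)
add-cell h t c = extension (skip ⊙ skip)
  (add-fact (headᴾ , _) (t , refl) (add-fact (tailᴾ , _) (h , refl) c))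
  (here refl , there (here refl))

add-succ : ∀ {L} k → Closed L → Extension L (λ F → F succᴾ k (suc k))
add-succ k c = extension skip (add-fact (succᴾ , _) refl c) (here refl)

add-call : ∀ {L} s {a r} → Closed L → (∀ w → Justified (members L) id w s a r) →
           Extension L (λ F → Call F (encode s) a r)
add-call s {a} c j with add-cell (encode s) a c
... | extension sub c′ x = extension (skip ⊙ sub)
  (add-fact (evalᴾ , _) (s , a , Cell-map skip x , λ w → Justified-map (skip ⊙ sub) s (j w)) c′)
  (_ , here refl , Cell-map skip x)

list : ∀ {n} → Vec ℕ n → ℕ
list []       = 0
list (x ∷ xs) = pair x (list xs)

add-evalᴾ : ∀ {n L} (i : Fin n) xs → Closed L →
            Extension L (λ F → Call F (encode (instructionᴾ i)) (list xs) (lookup xs i))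
add-evalᴾ zero (x ∷ xs) c =
  let extension s₁ c₁ cell₁ = add-cell x (list xs) c
      extension s₂ c₂ call₁ = add-call headᴵ c₁ (λ _ → proj₁ cell₁)
  in extension (s₂ ⊙ s₁) c₂ call₁
add-evalᴾ (suc i) (x ∷ xs) c =
  let extension s₁ c₁ call₁ = add-evalᴾ i xs c
      extension s₂ c₂ cell₁ = add-cell x (list xs) c₁
      extension s₃ c₃ call₂ = add-call (instructionᴾ (suc i)) c₂
                                (λ _ → _ , proj₂ cell₁ , Call-map s₂ call₁)
  in extension (s₃ ⊙ s₂ ⊙ s₁) c₃ call₂

below-suc : ∀ {P : ℕ → Set} {k} → P k → (∀ j → j < k → P j) → ∀ j → j < suc k → P j
below-suc {P} {k} pk ps j j<1+k with m≤n⇒m<n∨m≡n (s≤s⁻¹ j<1+k)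
... | inj₁ j<k  = ps j j<k
... | inj₂ refl = pk

-- Minimization needs evidence for every candidate below the result; `mono` carries the earlier
-- evidence into later extensions.
add-below : ∀ {L} (P : ℕ → Structure → Set) →
            (∀ j {L L′} → members L ⊑ members L′ → P j (members L) → P j (members L′)) →
            ∀ k → (∀ j → j < k → ∀ {L} → Closed L → Extension L (P j)) →
            Closed L → Extension L (λ F → ∀ j → j < k → P j F)
add-below P mono zero    add c = extension (λ _ _ _ → id) c (λ _ ())
add-below P mono (suc k) add c =
  let extension s₁ c₁ ps = add-below P mono k (λ j j<k → add j (m<n⇒m<1+n j<k)) c
      extension s₂ c₂ pk = add k ≤-refl c₁
  in extension (s₂ ⊙ s₁) c₂ (below-suc pk (λ j j<k → mono j s₂ (ps j j<k)))

Positive : ℕ → ℕ → ℕ → Structure → Set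
Positive i a j F = ∃[ l ] ∃[ v ] Cell F l j a × Call F i l v × 0 < v

mutual
  add-eval : ∀ {n L} {f : Rec n} {xs z} → f [ xs ]⇓ z → Closed L →
             Extension L (λ F → Call F (number f) (list xs) z)
  add-eval zero⇓ c = add-call zeroᴵ c (λ _ → refl)
  add-eval (suc⇓ {x}) c =
    let extension s₁ c₁ cell₁ = add-cell x 0 c
        extension s₂ c₂ succ₁ = add-succ x c₁
        extension s₃ c₃ call₁ = add-call sucᴵ c₂ (λ _ → _ , s₂ _ _ _ (proj₁ cell₁) , succ₁)
    in extension (s₃ ⊙ s₂ ⊙ s₁) c₃ call₁
  add-eval (proj⇓ {i = i} {xs}) c = add-evalᴾ i xs c
  add-eval {f = f} (comp⇓ ds d) c =
    let extension s₁ c₁ call₁ = add-evalᵛ ds c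
        extension s₂ c₂ call₂ = add-eval d c₁
        extension s₃ c₃ call₃ = add-call (instruction f) c₂ (λ _ → _ , Call-map s₂ call₁ , call₂)
    in extension (s₃ ⊙ s₂ ⊙ s₁) c₃ call₃
  add-eval {f = f} {xs = _ ∷ xs} (prim⇓-zero d) c =
    let extension s₁ c₁ call₁ = add-eval d c
        extension s₂ c₂ cell₁ = add-cell 0 (list xs) c₁
        extension s₃ c₃ call₂ = add-call (instruction f) c₂
          (λ _ → _ , _ , cell₁ , inj₁ (refl , Call-map s₂ call₁))
    in extension (s₃ ⊙ s₂ ⊙ s₁) c₃ call₂
  add-eval {f = f} (prim⇓-suc {xs = xs} {k} {y} d d′) c =
    let extension s₁ c₁ call₁ = add-eval d c
        extension s₂ c₂ call₂ = add-eval d′ c₁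
        -- The four cells are, in this order, the argument list and the lists `l₁`, `l₃`, `l₂` of
        -- `Justified`.
        extension s₃ c₃ cell₀ = add-cell (suc k) (list xs) c₂
        extension s₄ c₄ cell₁ = add-cell k (list xs) c₃
        extension s₅ c₅ cell₃ = add-cell y (list xs) c₄
        extension s₆ c₆ cell₂ = add-cell k (pair y (list xs)) c₅
        extension s₇ c₇ succ₁ = add-succ k c₆
        extension s₈ c₈ call₃ = add-call (instruction f) c₇ (λ _ → _ , _ ,
          Cell-map (s₇ ⊙ s₆ ⊙ s₅ ⊙ s₄) cell₀ , inj₂ (_ , _ , _ , _ , _ , succ₁ ,
          Cell-map (s₇ ⊙ s₆ ⊙ s₅) cell₁ , Call-map (s₇ ⊙ s₆ ⊙ s₅ ⊙ s₄ ⊙ s₃ ⊙ s₂) call₁ ,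
          Cell-map s₇ cell₂ , Cell-map (s₇ ⊙ s₆) cell₃ ,
          Call-map (s₇ ⊙ s₆ ⊙ s₅ ⊙ s₄ ⊙ s₃) call₂))
    in extension (s₈ ⊙ s₇ ⊙ s₆ ⊙ s₅ ⊙ s₄ ⊙ s₃ ⊙ s₂ ⊙ s₁) c₈ call₃
  add-eval {f = min f} {xs} (min⇓ {k = k} d below) c =
    let extension s₁ c₁ call₁ = add-eval d c
        extension s₂ c₂ cell₁ = add-cell k (list xs) c₁
        extension s₃ c₃ above = add-below (Positive (number f) (list xs))
          (λ { _ s (l , v , x , call , pos) → l , v , Cell-map s x , Call-map s call , pos })
          k (λ j j<k c → add-positive j (below j j<k) c) c₂
        extension s₄ c₄ call₂ = add-call (minᴵ (number f)) c₃ (λ w → _ ,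
          Cell-map s₃ cell₁ , Call-map (s₃ ⊙ s₂) call₁ , above w)
    in extension (s₄ ⊙ s₃ ⊙ s₂ ⊙ s₁) c₄ call₂

  add-positive : ∀ {n L} {f : Rec (1 + n)} {xs} j → ∃[ v ] f [ j ∷ xs ]⇓ suc v → Closed L →
                 Extension L (Positive (number f) (list xs) j)
  add-positive {xs = xs} j (v , d) c =
    let extension s₁ c₁ call₁ = add-eval d c
        extension s₂ c₂ cell₁ = add-cell j (list xs) c₁
    in extension (s₂ ⊙ s₁) c₂ (_ , _ , cell₁ , Call-map s₂ call₁ , s≤s z≤n)

  add-evalᵛ : ∀ {m n L} {gs : Vec (Rec n) m} {xs} {ys : Vec ℕ m} →
              Pointwise (λ g y → g [ xs ]⇓ y) gs ys → Closed L →
              Extension L (λ F → Call F (numberᵛ gs) (list xs) (list ys))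
  add-evalᵛ [] c = add-call nilᴵ c (λ _ → tt)
  add-evalᵛ {gs = gs} {ys = y ∷ ys} (d ∷ ds) c =
    let extension s₁ c₁ call₁ = add-eval d c
        extension s₂ c₂ call₂ = add-evalᵛ ds c₁
        extension s₃ c₃ cell₁ = add-cell y (list ys) c₂
        extension s₄ c₄ call₃ = add-call (instructionᵛ gs) c₃ (λ _ → _ , _ ,
          Call-map (s₃ ⊙ s₂) call₁ , Call-map s₃ call₂ , cell₁)
    in extension (s₄ ⊙ s₃ ⊙ s₂ ⊙ s₁) c₄ call₃

-- Completeness: a model from a run with result 0.

module _ (M : Marking) (θ ν : ℕ → ℕ) (node-holds : ∀ s → Holds M θ ν (node s)) where

  nodesᴾ-hold : ∀ {n} (i : Fin n) → Holds M θ ν (nodesᴾ i)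
  nodesᴾ-hold zero    = node-holds headᴵ
  nodesᴾ-hold (suc i) = node-holds (instructionᴾ (suc i)) , nodesᴾ-hold i

  mutual
    nodes-hold : ∀ {n} (f : Rec n) → Holds M θ ν (nodes f)
    nodes-hold zeroᴿ       = node-holds zeroᴵ
    nodes-hold sucᴿ        = node-holds sucᴵ
    nodes-hold (proj i)    = nodesᴾ-hold i
    nodes-hold (comp f gs) =
      node-holds (instruction (comp f gs)) , nodes-hold f , nodesᵛ-hold gs
    nodes-hold (prim g h)  = node-holds (instruction (prim g h)) , nodes-hold g , nodes-hold h
    nodes-hold (min f)     = node-holds (instruction (min f)) , nodes-hold f

    nodesᵛ-hold : ∀ {m n} (gs : Vec (Rec n) m) → Holds M θ ν (nodesᵛ gs)
    nodesᵛ-hold []       = node-holds nilᴵ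
    nodesᵛ-hold (g ∷ gs) = node-holds (instructionᵛ (g ∷ gs)) , nodes-hold g , nodesᵛ-hold gs

suc⇒adjacent : ∀ {a b} w → b ≡ suc a → a < b × (w ≤ a ⊎ b ≤ w)
suc⇒adjacent {a} w refl with <-≤-connex a w
... | inj₁ a<w = n<1+n a , inj₂ a<w
... | inj₂ w≤a = n<1+n a , inj₁ w≤a

module Completeness (f : Rec 1) (x : ℕ) (L : List Fact) (closed : Closed L)
                    (root : Call (members L) (number f) (pair x 0) 0)
                    (argument : members L headᴾ (pair x 0) x) where

  private
    M = marking L
    root-call : Call (structure M) (number f) (pair x 0) 0
    root-call = Call-map (members⇒structure {L}) root
    root-argument = members⇒structure {L} _ _ _ argument

  θ ν : ℕ → ℕ
  -- Tokens 19 to 21 are the `eval`, head and tail tokens of the root call; token 22 is the head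
  -- token of the argument.
  θ = (λ _ → 0) [ 19 ↦ proj₁ (proj₁ (proj₂ root-call)) ]
                [ 20 ↦ proj₁ (proj₁ (proj₂ (proj₂ root-call))) ]
                [ 21 ↦ proj₁ (proj₂ (proj₂ (proj₂ root-call))) ]
                [ 22 ↦ proj₁ root-argument ]
  -- Subtracting 16 makes `index k` denote `k`: numerals are correct and program numbers stand for
  -- themselves.
  ν = (λ n → n ∸ 16) [ 14 ↦ proj₁ root-call ] [ 15 ↦ pair x 0 ]

  functional-holds : ∀ p → (∀ {l a b} → members L p l a → members L p l b → a ≡ b) →
    ∀ {t t′} → place M t ≡ just p × place M t′ ≡ just p × color M zero t ≡ color M zero t′ →
    color M (suc zero) t ≡ color M (suc zero) t′
  functional-holds p unique {t} {t′} (eq , eq′ , l≡) =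
    unique (subst (λ l → members L p l _) l≡ (place⇒∈ L t eq)) (place⇒∈ L t′ eq′)

  head-unique : ∀ {l a b} → members L headᴾ l a → members L headᴾ l b → a ≡ b
  head-unique {a = a} {b} m m′ =
    let t , l≡ = closed m ; t′ , l≡′ = closed m′
    in proj₁ (pair-injective a t b t′ (trans (sym l≡) l≡′))

  tail-unique : ∀ {l a b} → members L tailᴾ l a → members L tailᴾ l b → a ≡ b
  tail-unique {a = a} {b} m m′ =
    let h , l≡ = closed m ; h′ , l≡′ = closed m′
    in proj₂ (pair-injective h a h′ b (trans (sym l≡) l≡′))

  module _ (w t t′ : ℕ) where

    private
      θ₂ = θ [ 0 ↦ t ] [ 1 ↦ t′ ]
      ν₁ = ν [ 0 ↦ w ]

    pinned-holds : ∀ ys cs k → Holds M (assign 2 17 ys θ₂) (assign 1 13 cs ν₁) (pinned k)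
    pinned-holds ys cs zero    = z≤n
    pinned-holds ys cs (suc k) = suc⇒adjacent w refl , pinned-holds ys cs k

    assemble : ∀ ys cs →
      Holds M (assign 2 17 ys θ₂) (assign 1 13 cs ν₁)
        (0 ∈ᴾ evalᴾ ⇒ token evalᴾ 0 (var 1) (var 2) ∧ cell 2 (var 1) (var 3) (var 4) ∧ nodes f) →
      Witnessed M θ ν (program f ∧ input x) w t t′
    assemble ys cs h = ys , cs ,
      ( (λ p → suc⇒adjacent w (closed (place⇒∈ L t p)))
      , functional-holds headᴾ head-unique {t} {t′} , functional-holds tailᴾ tail-unique {t} {t′}
      , h
      , proj₂ (proj₁ (proj₂ root-call)) , proj₂ (proj₁ (proj₂ (proj₂ root-call)))
      , proj₂ (proj₂ (proj₂ (proj₂ root-call))))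
      , proj₂ root-argument , pinned-holds ys cs x

    -- Off `eval` the implication is vacuous and zeros serve. Otherwise the `Good` property of the
    -- token supplies the instruction and all witnesses.
    witnessed : Witnessed M θ ν (program f ∧ input x) w t t′
    witnessed with Maybe.≡-dec Fin._≟_ (place M t) (just evalᴾ)
    ... | no  ≢eval = assemble (λ _ → 0) (λ _ → 0) (λ ≡eval → contradiction ≡eval ≢eval)
    ... | yes ≡eval with closed (place⇒∈ L t ≡eval)
    ...   | s , a , (h , tl) , j =
      let t₂ , h′ = members⇒structure _ _ _ h
          t₃ , tl′ = members⇒structure _ _ _ tl
          l = color M zero t
          r = color M (suc zero) t
          ts , cs , js = Justified⇒holds M θ₂ ν₁ t₂ t₃ l r (encode s) a s
                           (Justified-map (members⇒structure {L}) s (j w))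
          ys = values (t₂ ∷ t₃ ∷ ts)
          cs′ = values (l ∷ r ∷ encode s ∷ a ∷ cs)
          node-holds : ∀ s′ → Holds M (assign 2 17 ys θ₂) (assign 1 13 cs′ ν₁) (node s′)
          -- By injectivity of `encode`, a node whose guard holds is that of `s` itself.
          node-holds s′ eq =
            subst (λ s → Holds M (assign 2 17 ys θ₂) (assign 1 13 cs′ ν₁) (justified s))
                  (encode-injective eq) js
      in assemble ys cs′ (λ _ → (≡eval , refl , refl) , (h′ , tl′) ,
           nodes-hold M (assign 2 17 ys θ₂) (assign 1 13 cs′ ν₁) node-holds f)

  satisfiable : Satisfiable (sentence f x)
  satisfiable = θ , ν , M , closure-intro M θ ν (program f ∧ input x) witnessed

halts-0⇒satisfiable : ∀ f x → f [ x ∷ [] ]⇓ 0 → Satisfiable (sentence f x)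
halts-0⇒satisfiable f x d =
  let extension _  c₁ call₁ = add-eval {L = []} d (λ ())
      -- This cell provides the head token that ties the argument to `x`.
      extension s₂ c₂ cell₁ = add-cell x 0 c₁
  in Completeness.satisfiable f x _ c₂ (Call-map s₂ call₁) (proj₁ cell₁)

-- Computability of the codes

Computable : ∀ {n} → (Vec ℕ n → ℕ) → Set
Computable {n} f = Σ[ r ∈ Rec n ] ∀ xs → r [ xs ]⇓ f xs

module _ {n : ℕ} where

  const-computable : ∀ c → Computable {n} (λ _ → c)
  const-computable zero    = comp zeroᴿ [] , λ _ → comp⇓ [] zero⇓
  const-computable (suc c) =
    let r , h = const-computable c
    in comp sucᴿ (r ∷ []) , λ xs → comp⇓ (h xs ∷ []) suc⇓

  lookup-computable : ∀ i → Computable {n} (λ xs → lookup xs i)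
  lookup-computable i = proj i , λ _ → proj⇓

  comp₁-computable : ∀ {f : Vec ℕ 1 → ℕ} {g : Vec ℕ n → ℕ} → Computable f → Computable g →
                     Computable (λ xs → f (g xs ∷ []))
  comp₁-computable (r , h) (s , k) = comp r (s ∷ []) , λ xs → comp⇓ (k xs ∷ []) (h _)

  comp₂-computable : ∀ {f : Vec ℕ 2 → ℕ} {g g′ : Vec ℕ n → ℕ} →
                     Computable f → Computable g → Computable g′ →
                     Computable (λ xs → f (g xs ∷ g′ xs ∷ []))
  comp₂-computable (r , h) (s , k) (s′ , k′) =
    comp r (s ∷ s′ ∷ []) , λ xs → comp⇓ (k xs ∷ k′ xs ∷ []) (h _)

  suc-computable : ∀ {f : Vec ℕ n → ℕ} → Computable f → Computable (suc ∘ f)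
  suc-computable (r , h) = comp sucᴿ (r ∷ []) , λ xs → comp⇓ (h xs ∷ []) suc⇓

  -- The target `f` comes with recursion equations up to `≡`, because opaque codes satisfy theirs
  -- only propositionally.
  prim-computable : ∀ {g : Vec ℕ n → ℕ} {h : Vec ℕ (2 + n) → ℕ} → Computable g → Computable h →
    (f : ℕ → Vec ℕ n → ℕ) → (∀ xs → g xs ≡ f 0 xs) →
    (∀ k xs → h (k ∷ f k xs ∷ xs) ≡ f (suc k) xs) →
    Computable {suc n} (λ { (k ∷ xs) → f k xs })
  prim-computable {g} {h} (r , p) (s , q) f base step = prim r s , λ { (k ∷ xs) → go k xs }
    where
    go : ∀ k xs → prim r s [ k ∷ xs ]⇓ f k xs
    go zero    xs = prim⇓-zero (subst (r [ xs ]⇓_) (base xs) (p xs))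
    go (suc k) xs = prim⇓-suc (go k xs) (subst (s [ _ ]⇓_) (step k xs) (q _))

+-computable : ∀ {n} {f g : Vec ℕ n → ℕ} → Computable f → Computable g →
               Computable (λ xs → f xs + g xs)
+-computable = comp₂-computable
  (prim-computable (lookup-computable zero) (suc-computable (lookup-computable (suc zero)))
    (λ k xs → k + lookup xs zero) (λ _ → refl) (λ _ _ → refl))

triangle-computable : ∀ {n} {f : Vec ℕ n → ℕ} → Computable f → Computable (triangle ∘ f)
triangle-computable = comp₁-computable
  (prim-computable (const-computable 0)
    (+-computable (suc-computable (lookup-computable zero)) (lookup-computable (suc zero)))
    (λ k _ → triangle k) (λ _ → refl) (λ _ _ → refl))

Computable-resp : ∀ {n} {f g : Vec ℕ n → ℕ} → (∀ xs → f xs ≡ g xs) → Computable f → Computable g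
Computable-resp f≗g (r , h) = r , λ xs → subst (r [ xs ]⇓_) (f≗g xs) (h xs)

-- Opaque copies of the coding functions: unfolding the arithmetic of nested
-- pairs during conversion checking is exponential in the depth of the nesting.
abstract
  ⟪_,_⟫ : ℕ → ℕ → ℕ
  ⟪ a , b ⟫ = pair a b

  #_ : Formula → ℕ
  # φ = codeFormula φ

  #ᵀ_ : Term → ℕ
  #ᵀ t = codeTerm t

  pair-computable : ∀ {n} {f g : Vec ℕ n → ℕ} → Computable f → Computable g →
                    Computable (λ xs → ⟪ f xs , g xs ⟫)
  pair-computable {f = f} {g} p q =
    +-computable {f = λ xs → triangle (f xs + g xs)} (triangle-computable (+-computable p q)) q

  ⟪⟫≡pair : ∀ a b → ⟪ a , b ⟫ ≡ pair a b
  ⟪⟫≡pair a b = refl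

  #≡codeFormula : ∀ φ → # φ ≡ codeFormula φ
  #≡codeFormula φ = refl

  #ᵀ≡codeTerm : ∀ t → #ᵀ t ≡ codeTerm t
  #ᵀ≡codeTerm t = refl

⟪⟫-cong-pair : ∀ a {b c} → b ≡ c → ⟪ a , b ⟫ ≡ pair a c
⟪⟫-cong-pair a refl = ⟪⟫≡pair a _

#-¬ : ∀ φ → ⟪ 4 , # φ ⟫ ≡ # (¬′ φ)
#-¬ φ = trans (⟪⟫-cong-pair 4 (#≡codeFormula φ)) (sym (#≡codeFormula (¬′ φ)))

#-∨ : ∀ φ ψ → ⟪ 5 , ⟪ # φ , # ψ ⟫ ⟫ ≡ # (φ ∨′ ψ)
#-∨ φ ψ = trans
  (⟪⟫-cong-pair 5 (trans (⟪⟫≡pair (# φ) (# ψ)) (cong₂ pair (#≡codeFormula φ) (#≡codeFormula ψ))))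
  (sym (#≡codeFormula (φ ∨′ ψ)))

#-∃ : ∀ y φ → ⟪ 6 , ⟪ codeVar y , # φ ⟫ ⟫ ≡ # (∃′ y φ)
#-∃ y φ = trans
  (⟪⟫-cong-pair 6 (⟪⟫-cong-pair (codeVar y) (#≡codeFormula φ)))
  (sym (#≡codeFormula (∃′ y φ)))

#-leq : ∀ s t → ⟪ 3 , ⟪ #ᵀ s , #ᵀ t ⟫ ⟫ ≡ # leq s t
#-leq s t = trans
  (⟪⟫-cong-pair 3 (trans (⟪⟫≡pair (#ᵀ s) (#ᵀ t)) (cong₂ pair (#ᵀ≡codeTerm s) (#ᵀ≡codeTerm t))))
  (sym (#≡codeFormula (leq s t)))

#ᵀ-var : ∀ z → ⟪ 0 , z ⟫ ≡ #ᵀ var z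
#ᵀ-var z = trans (⟪⟫≡pair 0 z) (sym (#ᵀ≡codeTerm (var z)))

decides-formula : ∀ {r} → r Decides Π₂Satisfiable via code → ∀ {φ} → IsΠ 2 φ →
                  (Satisfiable φ → r [ ⟪ 4 , # φ ⟫ ∷ [] ]⇓ 1) ×
                  (¬ Satisfiable φ → r [ ⟪ 4 , # φ ⟫ ∷ [] ]⇓ 0)
decides-formula {r} decides {φ} h = run ∘ proj₁ (decides i) , run ∘ proj₂ (decides i)
  where
  i = record { places = 4 ; formula = φ ; isΠ₂ = h }

  run : ∀ {z} → r [ pair 4 (codeFormula φ) ∷ [] ]⇓ z → r [ ⟪ 4 , # φ ⟫ ∷ [] ]⇓ z
  run = subst (λ c → r [ c ∷ [] ]⇓ _) (sym (⟪⟫-cong-pair 4 (#≡codeFormula φ)))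

-- Codes of composite formulas.

¬-code : ℕ → ℕ
¬-code a = ⟪ 4 , a ⟫

∨-code : ℕ → ℕ → ℕ
∨-code a b = ⟪ 5 , ⟪ a , b ⟫ ⟫

∧-code : ℕ → ℕ → ℕ
∧-code a b = ¬-code (∨-code (¬-code a) (¬-code b))

∃-code : Var → ℕ → ℕ
∃-code y a = ⟪ 6 , ⟪ codeVar y , a ⟫ ⟫

∀-code : Var → ℕ → ℕ
∀-code y a = ¬-code (∃-code y (¬-code a))

exists-code : (ℕ → Var) → (s k : ℕ) → ℕ → ℕ
exists-code V s zero    a = a
exists-code V s (suc k) a = ∃-code (V s) (exists-code V (suc s) k a)

closure-code : ℕ → ℕ
closure-code a =
  ∀-code (col 0) (∀-code (tok 0) (∀-code (tok 1) (exists-code tok 2 17 (exists-code col 1 13 a))))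

#-∧ : ∀ φ ψ → ∧-code (# φ) (# ψ) ≡ # (φ ∧′ ψ)
#-∧ φ ψ = trans
  (cong ¬-code (trans (cong₂ ∨-code (#-¬ φ) (#-¬ ψ)) (#-∨ (¬′ φ) (¬′ ψ))))
  (#-¬ (¬′ φ ∨′ ¬′ ψ))

#-∀ : ∀ y φ → ∀-code y (# φ) ≡ # (∀′ y φ)
#-∀ y φ = trans
  (cong ¬-code (trans (cong (∃-code y) (#-¬ φ)) (#-∃ y (¬′ φ))))
  (#-¬ (∃′ y (¬′ φ)))

#-exists : ∀ V s k φ → exists-code V s k (# φ) ≡ # exists V s k φ
#-exists V s zero    φ = refl
#-exists V s (suc k) φ =
  trans (cong (∃-code (V s)) (#-exists V (suc s) k φ)) (#-∃ (V s) (exists V (suc s) k φ))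

#-closure : ∀ φ → closure-code (# φ) ≡ # closure φ
#-closure φ =
  trans (cong (∀-code (col 0)) (trans (cong (∀-code (tok 0)) (trans (cong (∀-code (tok 1))
    (trans (cong (exists-code tok 2 17) (#-exists col 1 13 φ))
           (#-exists tok 2 17 (exists col 1 13 φ))))
    (#-∀ (tok 1) _))) (#-∀ (tok 0) _))) (#-∀ (col 0) _)

module _ {n : ℕ} where

  private
    variable
      f g : Vec ℕ n → ℕ

  ¬-computable : Computable f → Computable (λ xs → ¬-code (f xs))
  ¬-computable f = pair-computable (const-computable 4) f

  ∨-computable : Computable f → Computable g → Computable (λ xs → ∨-code (f xs) (g xs))
  ∨-computable f g = pair-computable (const-computable 5) (pair-computable f g)

  ∧-computable : Computable f → Computable g → Computable (λ xs → ∧-code (f xs) (g xs))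
  ∧-computable f g = ¬-computable (∨-computable (¬-computable f) (¬-computable g))

  ∃-computable : ∀ y → Computable f → Computable (λ xs → ∃-code y (f xs))
  ∃-computable y f = pair-computable (const-computable 6)
    (pair-computable (const-computable (codeVar y)) f)

  ∀-computable : ∀ y → Computable f → Computable (λ xs → ∀-code y (f xs))
  ∀-computable y f = ¬-computable (∃-computable y (¬-computable f))

  exists-computable : ∀ V s k → Computable f → Computable (λ xs → exists-code V s k (f xs))
  exists-computable V s zero    f = f
  exists-computable V s (suc k) f = ∃-computable (V s) (exists-computable V (suc s) k f)

  closure-computable : Computable f → Computable (λ xs → closure-code (f xs))
  closure-computable f = ∀-computable (col 0) (∀-computable (tok 0) (∀-computable (tok 1)
    (exists-computable tok 2 17 (exists-computable col 1 13 f))))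

  index-computable : Computable f → Computable (λ xs → #ᵀ index (f xs))
  index-computable f = Computable-resp (λ _ → #ᵀ-var _)
    (pair-computable (const-computable 0) (+-computable (const-computable 16) f))

  private
    variable
      φ ψ : Vec ℕ n → Formula
      s t : Vec ℕ n → Term

  #-∨-computable : Computable (λ xs → # φ xs) → Computable (λ xs → # ψ xs) →
                   Computable (λ xs → # (φ xs ∨′ ψ xs))
  #-∨-computable f g = Computable-resp (λ _ → #-∨ _ _) (∨-computable f g)

  #-∧-computable : Computable (λ xs → # φ xs) → Computable (λ xs → # ψ xs) →
                   Computable (λ xs → # (φ xs ∧′ ψ xs))
  #-∧-computable f g = Computable-resp (λ _ → #-∧ _ _) (∧-computable f g)

  ≲-computable : Computable (λ xs → #ᵀ s xs) → Computable (λ xs → #ᵀ t xs) →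
                 Computable (λ xs → # toFormula (s xs ≲ t xs))
  ≲-computable f g = Computable-resp (λ _ → #-leq _ _)
    (pair-computable (const-computable 3) (pair-computable f g))

  ≺-computable : Computable (λ xs → #ᵀ s xs) → Computable (λ xs → #ᵀ t xs) →
                 Computable (λ xs → # toFormula (s xs ≺ t xs))
  ≺-computable f g = Computable-resp (λ _ → #-¬ _) (¬-computable (≲-computable g f))

  ≈-computable : Computable (λ xs → #ᵀ s xs) → Computable (λ xs → #ᵀ t xs) →
                 Computable (λ xs → # toFormula (s xs ≈ t xs))
  ≈-computable f g = #-∧-computable (≲-computable f g) (≲-computable g f)

  adjacent-computable : Computable (λ xs → #ᵀ s xs) → Computable (λ xs → #ᵀ t xs) →
                        Computable (λ xs → # toFormula (adjacent (s xs) (t xs)))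
  adjacent-computable f g = #-∧-computable (≺-computable f g)
    (#-∨-computable (≲-computable w f) (≲-computable g w))
    where
    w = const-computable (#ᵀ var 0)

pinned-computable : Computable {1} (λ xs → # toFormula (pinned (lookup xs zero)))
pinned-computable =
  let r , h = prim-computable
        (const-computable (# toFormula (pinned 0)))
        (∧-computable
          (adjacent-computable (index-computable (lookup-computable zero))
                               (index-computable (suc-computable (lookup-computable zero))))
          (lookup-computable (suc zero)))
        (λ k _ → # toFormula (pinned k))
        (λ _ → refl)
        (λ _ _ → #-∧ _ _)
  in r , λ { (k ∷ []) → h (k ∷ []) }

input-computable : Computable {1} (λ xs → # toFormula (input (lookup xs zero)))
input-computable = #-∧-computable
  (#-∧-computable (const-computable _) (#-∧-computable (const-computable _)
    (≈-computable (const-computable _) (index-computable (lookup-computable zero)))))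
  pinned-computable

-- The diagonal argument.

diagonal : ℕ → ℕ
diagonal x = ⟪ 4 , closure-code (∧-code x (# toFormula (input x))) ⟫

diagonal-computable : Computable {1} (λ xs → diagonal (lookup xs zero))
diagonal-computable = pair-computable (const-computable 4)
  (closure-computable (∧-computable (lookup-computable zero) input-computable))

-- In `diagonal` the number `x` serves both as the code of the first conjunct and as the input; here
-- that conjunct is the part belonging to `f`.
diagonal-correct : ∀ f → let x = # toFormula (program f) in diagonal x ≡ ⟪ 4 , # sentence f x ⟫
diagonal-correct f = cong ⟪ 4 ,_⟫ (trans
  (cong closure-code (#-∧ (toFormula (program f)) (toFormula (input x))))
  (#-closure (toFormula (program f ∧ input x))))
  where
  x = # toFormula (program f)

theorem3p1 : Undecidable Π₂Satisfiable code
theorem3p1 (decider , decides) =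
  -- Satisfiability is refuted outright; the decider must then answer 0, so `f` returns 0 and the
  -- sentence has a model after all.
  unsatisfiable (halts-0⇒satisfiable f x (run (proj₂ halts unsatisfiable)))
  where
  f = comp decider (proj₁ diagonal-computable ∷ [])
  x = # toFormula (program f)
  halts = decides-formula decides (closure-Π₂ (quantifierFree (program f ∧ input x)))

  run : ∀ {z} → decider [ ⟪ 4 , # sentence f x ⟫ ∷ [] ]⇓ z → f [ x ∷ [] ]⇓ z
  run d = comp⇓ (subst (proj₁ diagonal-computable [ x ∷ [] ]⇓_) (diagonal-correct f)
                       (proj₂ diagonal-computable (x ∷ [])) ∷ []) d

  unsatisfiable : ¬ Satisfiable (sentence f x)
  -- A model would make the decider, hence `f`, answer 1, while soundness allows only 0.
  unsatisfiable s@(θ , ν , M , m) =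
    contradiction (Soundness.result-zero f x M θ ν m (run (proj₁ halts s))) (λ ())
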